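{- All three of the subseries numbers $\text{\ss}$, $\text{\ss}_i$ and $\text{\ss}_o$ are uncountable.
   Context: $\mathbb{N}=\{1,2,3,\dots\}$. For $A\subseteq\mathbb{N}$, the subseries $\sum_{n\in A}a_n$ is summed in increasing order of the indices; if $A$ is finite it counts as convergent. A series is conditionally convergent if it converges but not absolutely. A series diverges by oscillation if its partial sums neither converge to a real number nor tend to $+\infty$ nor tend to $-\infty$. The subseries number $\text{\ss}$ is the smallest cardinality of a family $\mathcal{A}$ of subsets of $\mathbb{N}$ such that for every conditionally convergent series $\sum_{n\in\mathbb{N}}a_n$ of real numbers there is $A\in\mathcal{A}$ such that $\sum_{n\in A}a_n$ diverges. $\text{\ss}_i$ (respectively $\text{\ss}_o$) is defined in the same way, except that $\sum_{n\in A}a_n$ is required to diverge to $+\infty$ or to $-\infty$ (respectively, to diverge by oscillation). -}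

module Defs where

open import Level using (Level; 0ℓ; _⊔_) renaming (suc to lsuc)
open import Data.Bool.Base using (Bool; if_then_else_)
open import Data.Maybe.Base using (Maybe; just)
open import Data.Maybe.Relation.Binary.Pointwise using (Pointwise)
open import Data.Nat.Base as ℕ using (ℕ; zero; suc)
import Data.Nat.Properties as ℕ
open import Data.Product.Base using (∃; ∃-syntax; _×_; _,_; proj₁; proj₂)
open import Data.Rational.Base as ℚ using (ℚ; 0ℚ; ½)
import Data.Rational.Properties as ℚ
open import Data.Rational.Solver using (module +-*-Solver)
open import Data.Sum.Base using (_⊎_; inj₁; inj₂)
open import Function.Bundles using (Bijection; Injection)
open import Relation.Binary.Bundles using (Setoid)
import Relation.Binary.Construct.On as On
open import Relation.Binary.PropositionalEquality
  using (_≡_; refl; sym; trans; cong; cong₂; subst; subst₂; _→-setoid_)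
open import Relation.Nullary.Negation.Core using (¬_)
open import Relation.Unary using (Pred; _∈_)

private
  variable
    c e ℓ : Level

------------------------------------------------------------------------
-- Real numbers as Cauchy sequences of rationals.  Distinct sequences may
-- represent the same real; every notion below depends only on the reals
-- represented.

IsCauchy : (ℕ → ℚ) → Set
IsCauchy x = ∀ ε → 0ℚ ℚ.< ε →
  ∃[ N ] ∀ m n → N ℕ.≤ m → N ℕ.≤ n → ℚ.∣ x m ℚ.- x n ∣ ℚ.< ε

record ℝ : Set where
  constructor mkℝ
  field
    approx : ℕ → ℚ
    cauchy : IsCauchy approx

open ℝ public

private
  half-pos : ∀ ε → 0ℚ ℚ.< ε → 0ℚ ℚ.< ½ ℚ.* ε
  half-pos ε ε>0 =
    subst (ℚ._< ½ ℚ.* ε) (ℚ.*-zeroʳ ½) (ℚ.*-monoʳ-<-pos ½ ε>0)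

  half+half : ∀ ε → ½ ℚ.* ε ℚ.+ ½ ℚ.* ε ≡ ε
  half+half ε = trans (sym (ℚ.*-distribʳ-+ ε ½ ½)) (ℚ.*-identityˡ ε)

  +-diff : ∀ p q r s →
    (p ℚ.+ q) ℚ.- (r ℚ.+ s) ≡ (p ℚ.- r) ℚ.+ (q ℚ.- s)
  +-diff = solve 4 (λ p q r s →
    (p :+ q) :- (r :+ s) := (p :- r) :+ (q :- s)) refl
    where open +-*-Solver

  neg-diff : ∀ p q → (ℚ.- p) ℚ.- (ℚ.- q) ≡ ℚ.- (p ℚ.- q)
  neg-diff = solve 2 (λ p q → (:- p) :- (:- q) := :- (p :- q)) refl
    where open +-*-Solver

  swap-diff : ∀ p q → ℚ.- (p ℚ.- q) ≡ q ℚ.- p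
  swap-diff = solve 2 (λ p q → :- (p :- q) := q :- p) refl
    where open +-*-Solver

  diff+ : ∀ p q → (p ℚ.- q) ℚ.+ q ≡ p
  diff+ = solve 2 (λ p q → (p :- q) :+ q := p) refl
    where open +-*-Solver

  +diff : ∀ p q → (p ℚ.+ q) ℚ.- q ≡ p
  +diff = solve 2 (λ p q → (p :+ q) :- q := p) refl
    where open +-*-Solver

  ∣p∣-∣q∣≤∣p-q∣ : ∀ p q → ℚ.∣ p ∣ ℚ.- ℚ.∣ q ∣ ℚ.≤ ℚ.∣ p ℚ.- q ∣
  ∣p∣-∣q∣≤∣p-q∣ p q = begin
    ℚ.∣ p ∣ ℚ.- ℚ.∣ q ∣                       ≡⟨ cong (λ r → ℚ.∣ r ∣ ℚ.- ℚ.∣ q ∣) (diff+ p q) ⟨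
    ℚ.∣ (p ℚ.- q) ℚ.+ q ∣ ℚ.- ℚ.∣ q ∣         ≤⟨ ℚ.+-monoˡ-≤ (ℚ.- ℚ.∣ q ∣) (ℚ.∣p+q∣≤∣p∣+∣q∣ (p ℚ.- q) q) ⟩
    (ℚ.∣ p ℚ.- q ∣ ℚ.+ ℚ.∣ q ∣) ℚ.- ℚ.∣ q ∣   ≡⟨ +diff ℚ.∣ p ℚ.- q ∣ ℚ.∣ q ∣ ⟩
    ℚ.∣ p ℚ.- q ∣                             ∎
    where open ℚ.≤-Reasoning

  ∣∣p∣-∣q∣∣≤∣p-q∣ : ∀ p q → ℚ.∣ ℚ.∣ p ∣ ℚ.- ℚ.∣ q ∣ ∣ ℚ.≤ ℚ.∣ p ℚ.- q ∣
  ∣∣p∣-∣q∣∣≤∣p-q∣ p q with ℚ.∣p∣≡p∨∣p∣≡-p (ℚ.∣ p ∣ ℚ.- ℚ.∣ q ∣)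
  ... | inj₁ eq = subst (ℚ._≤ ℚ.∣ p ℚ.- q ∣) (sym eq) (∣p∣-∣q∣≤∣p-q∣ p q)
  ... | inj₂ eq = subst₂ ℚ._≤_
    (sym (trans eq (swap-diff ℚ.∣ p ∣ ℚ.∣ q ∣)))
    (trans (cong ℚ.∣_∣ (sym (swap-diff p q))) (ℚ.∣-p∣≡∣p∣ (p ℚ.- q)))
    (∣p∣-∣q∣≤∣p-q∣ q p)

infixl 6 _+_ _-_
infix  8 -_
infix  4 _<_

0ℝ : ℝ
0ℝ = mkℝ (λ _ → 0ℚ) (λ _ ε>0 → 0 , λ _ _ _ _ → ε>0)

_+_ : ℝ → ℝ → ℝ
mkℝ x xc + mkℝ y yc = mkℝ (λ n → x n ℚ.+ y n) λ ε ε>0 →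
  let (M , xM) = xc (½ ℚ.* ε) (half-pos ε ε>0)
      (N , yN) = yc (½ ℚ.* ε) (half-pos ε ε>0)
  in M ℕ.⊔ N , λ m n m≥ n≥ → begin-strict
    ℚ.∣ (x m ℚ.+ y m) ℚ.- (x n ℚ.+ y n) ∣
      ≡⟨ cong ℚ.∣_∣ (+-diff (x m) (y m) (x n) (y n)) ⟩
    ℚ.∣ (x m ℚ.- x n) ℚ.+ (y m ℚ.- y n) ∣
      ≤⟨ ℚ.∣p+q∣≤∣p∣+∣q∣ (x m ℚ.- x n) (y m ℚ.- y n) ⟩
    ℚ.∣ x m ℚ.- x n ∣ ℚ.+ ℚ.∣ y m ℚ.- y n ∣
      <⟨ ℚ.+-mono-< (xM m n (ℕ.m⊔n≤o⇒m≤o M N m≥) (ℕ.m⊔n≤o⇒m≤o M N n≥))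
                    (yN m n (ℕ.m⊔n≤o⇒n≤o M N m≥) (ℕ.m⊔n≤o⇒n≤o M N n≥)) ⟩
    ½ ℚ.* ε ℚ.+ ½ ℚ.* ε
      ≡⟨ half+half ε ⟩
    ε ∎
  where open ℚ.≤-Reasoning

-_ : ℝ → ℝ
- mkℝ x xc = mkℝ (λ n → ℚ.- x n) λ ε ε>0 →
  let (N , xN) = xc ε ε>0
  in N , λ m n m≥ n≥ → subst (ℚ._< ε)
    (sym (trans (cong ℚ.∣_∣ (neg-diff (x m) (x n))) (ℚ.∣-p∣≡∣p∣ (x m ℚ.- x n))))
    (xN m n m≥ n≥)

_-_ : ℝ → ℝ → ℝ
x - y = x + (- y)

∣_∣ : ℝ → ℝ
∣ mkℝ x xc ∣ = mkℝ (λ n → ℚ.∣ x n ∣) λ ε ε>0 →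
  let (N , xN) = xc ε ε>0
  in N , λ m n m≥ n≥ →
    ℚ.≤-<-trans (∣∣p∣-∣q∣∣≤∣p-q∣ (x m) (x n)) (xN m n m≥ n≥)

_<_ : ℝ → ℝ → Set
x < y = ∃[ δ ] 0ℚ ℚ.< δ ×
  ∃[ N ] ∀ n → N ℕ.≤ n → approx x n ℚ.+ δ ℚ.≤ approx y n

------------------------------------------------------------------------
-- Series.  A series is given by its terms; the index set {1,2,3,…} is
-- relabelled as {0,1,2,…}.

Series : Set
Series = ℕ → ℝ

partialSum : Series → ℕ → ℝ
partialSum a zero    = 0ℝ
partialSum a (suc n) = partialSum a n + a n

_⟶_ : (ℕ → ℝ) → ℝ → Set
s ⟶ l = ∀ ε → 0ℝ < ε → ∃[ N ] ∀ n → N ℕ.≤ n → ∣ s n - l ∣ < ε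

_⟶+∞ : (ℕ → ℝ) → Set
s ⟶+∞ = ∀ b → ∃[ N ] ∀ n → N ℕ.≤ n → b < s n

_⟶-∞ : (ℕ → ℝ) → Set
s ⟶-∞ = ∀ b → ∃[ N ] ∀ n → N ℕ.≤ n → s n < b

Converges : Series → Set
Converges a = ∃[ l ] partialSum a ⟶ l

ConvergesAbsolutely : Series → Set
ConvergesAbsolutely a = Converges (λ n → ∣ a n ∣)

ConvergesConditionally : Series → Set
ConvergesConditionally a = Converges a × ¬ ConvergesAbsolutely a

Diverges : Series → Set
Diverges a = ¬ Converges a

DivergesToInfinity : Series → Set
DivergesToInfinity a = partialSum a ⟶+∞ ⊎ partialSum a ⟶-∞

DivergesByOscillation : Series → Set
DivergesByOscillation a =
  ¬ Converges a × ¬ (partialSum a ⟶+∞) × ¬ (partialSum a ⟶-∞)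

-- Subsets of ℕ, as characteristic functions.
Subset : Set
Subset = ℕ → Bool

-- The subseries over A, with the terms outside A replaced by 0 instead of
-- being skipped.  Its partial sums are those of the subseries in increasing
-- order of indices, with repetitions, which affects neither convergence nor
-- the mode of divergence; for finite A they are eventually constant.
_↾_ : Series → Subset → Series
(a ↾ A) n = if A n then a n else 0ℝ

------------------------------------------------------------------------
-- Cardinalities.  Cardinals are represented by setoids.

-- A family of subsets as a setoid, identifying extensionally equal members.
⟦_⟧ : Pred Subset ℓ → Setoid ℓ 0ℓ
⟦ 𝒜 ⟧ = On.setoid {B = ∃ 𝒜} (ℕ →-setoid Bool) proj₁

-- Finite or countably infinite; Maybe allows for the empty setoid.
Countable : Setoid c e → Set (c ⊔ e)
Countable S = ∃ λ (f : ℕ → Maybe Carrier) →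
  ∀ x → ∃[ n ] Pointwise _≈_ (f n) (just x)
  where open Setoid S

Uncountable : Setoid c e → Set (c ⊔ e)
Uncountable S = ¬ Countable S

record IsLeastCardinality (P : Pred (Pred Subset ℓ) ℓ) (κ : Setoid c e)
  : Set (lsuc ℓ ⊔ c ⊔ e) where
  field
    attained : ∃[ 𝒜 ] P 𝒜 × Bijection ⟦ 𝒜 ⟧ κ
    least    : ∀ ℬ → P ℬ → Injection κ ⟦ ℬ ⟧

-- The least cardinality of a family satisfying P is uncountable.  That a
-- least cardinality exists at all depends on choice, so the first clause
-- alone might hold vacuously; the second does not rely on its existence.
LeastCardinalityUncountable : (c e : Level) → Pred (Pred Subset ℓ) ℓ →
                              Set (lsuc (ℓ ⊔ c ⊔ e))
LeastCardinalityUncountable c e P =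
  (∀ (κ : Setoid c e) → IsLeastCardinality P κ → Uncountable κ) ×
  (∀ 𝒜 → P 𝒜 → Uncountable ⟦ 𝒜 ⟧)

------------------------------------------------------------------------
-- The families whose least cardinalities are ß, ßᵢ and ßₒ.

SubseriesFamily : Pred Series 0ℓ → Pred (Pred Subset ℓ) ℓ
SubseriesFamily D 𝒜 =
  ∀ a → ConvergesConditionally a → ∃[ A ] A ∈ 𝒜 × D (a ↾ A)

ß-Family ßᵢ-Family ßₒ-Family : Pred (Pred Subset ℓ) ℓ
ß-Family  = SubseriesFamily Diverges
ßᵢ-Family = SubseriesFamily DivergesToInfinity
ßₒ-Family = SubseriesFamily DivergesByOscillation

{-# OPTIONS --safe #-}

-- Given subsets A₀, A₁, …, pick disjoint consecutive pairs p₀ < q₀ < p₁ < q₁ < …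
-- such that none of A₀, …, A_{m-1} separates p_m from q_m (pigeonhole on the
-- 2^m possible membership patterns).  The series with terms 1/(m+1) at p_m,
-- -1/(m+1) at q_m and 0 elsewhere converges conditionally, and over each A_k all
-- but finitely many pairs are either dropped or cancel, so every subseries over
-- an A_k converges.
module Submission where

open import Defs
open import Level using (Level; 0ℓ)
open import Data.Bool.Base using (Bool; true; false; if_then_else_; _∧_)
open import Data.Bool.Properties using (if-eta)
open import Data.Fin.Base using (Fin; zero; suc; toℕ; fromℕ<; funToFin; finToFun)
open import Data.Fin.Properties using (pigeonhole; finToFun-funToFin; toℕ-fromℕ<)
open import Data.Integer.Base as ℤ using (+_; +[1+_]; -[1+_]; +≤+)
import Data.Integer.Properties as ℤ
open import Data.Maybe.Base as Maybe using (Maybe; just; maybe)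
open import Data.Maybe.Relation.Binary.Pointwise using (Pointwise; just)
open import Data.Nat.Base as ℕ using (ℕ; zero; suc; z≤n; s≤s)
open import Data.Nat.Coprimality as Coprimality using (1-coprimeTo)
import Data.Nat.Properties as ℕ
open import Data.Product.Base using (∃; ∃-syntax; _×_; _,_; proj₁; proj₂)
open import Data.Rational.Base as ℚ using (ℚ; mkℚ; 0ℚ; ½; 1ℚ; *≤*)
import Data.Rational.Properties as ℚ
import Data.Rational.Unnormalised.Base as ℚᵘ
import Data.Rational.Unnormalised.Properties as ℚᵘ
open import Data.Rational.Solver using (module +-*-Solver)
open import Data.Sum.Base using (inj₁; inj₂)
open import Function.Base using (_∘_; id)
open import Function.Bundles using (Bijection)
open import Relation.Binary.Bundles using (Setoid)
open import Relation.Binary.PropositionalEquality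
open import Relation.Nullary using (¬_; Dec; yes; no; does)
open import Relation.Nullary.Decidable using (dec-true; dec-false)
open import Relation.Unary using (Pred; _⊆_)

private
  variable
    c e ℓ : Level

-- Rational approximations and elementary inequalities.

fromℚ : ℚ → ℝ
fromℚ x = mkℝ (λ _ → x) λ ε ε>0 → 0 , λ _ _ _ _ →
  subst (ℚ._< ε) (cong ℚ.∣_∣ (sym (ℚ.+-inverseʳ x))) ε>0

fromℚ-pos : ∀ {x} → 0ℚ ℚ.< x → 0ℝ < fromℚ x
fromℚ-pos {x} x>0 = x , x>0 , 0 , λ _ _ → ℚ.≤-reflexive (ℚ.+-identityˡ x)

p<p+δ : ∀ p {δ} → 0ℚ ℚ.< δ → p ℚ.< p ℚ.+ δ
p<p+δ p δ>0 = subst (ℚ._< p ℚ.+ _) (ℚ.+-identityʳ p) (ℚ.+-monoʳ-< p δ>0)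

-- Several real inequalities can then be compared at one late index, as inequalities of rationals.
<⇒approx< : ∀ {x y} → x < y → ∃[ N ] ∀ i → N ℕ.≤ i → approx x i ℚ.< approx y i
<⇒approx< {x} (δ , δ>0 , N , x+δ≤y) =
  N , λ i N≤i → ℚ.<-≤-trans (p<p+δ (approx x i) δ>0) (x+δ≤y i N≤i)

halve-pos : ∀ {ε} → 0ℚ ℚ.< ε → 0ℚ ℚ.< ½ ℚ.* ε
halve-pos {ε} ε>0 = subst (ℚ._< ½ ℚ.* ε) (ℚ.*-zeroʳ ½) (ℚ.*-monoʳ-<-pos ½ ε>0)

½p+½p≡p : ∀ p → ½ ℚ.* p ℚ.+ ½ ℚ.* p ≡ p
½p+½p≡p = solve 1 (λ p → con ½ :* p :+ con ½ :* p := p) refl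
  where open +-*-Solver

p≤∣p∣ : ∀ p → p ℚ.≤ ℚ.∣ p ∣
p≤∣p∣ p with ℚ.≤-total 0ℚ p
... | inj₁ 0≤p = ℚ.≤-reflexive (sym (ℚ.0≤p⇒∣p∣≡p 0≤p))
... | inj₂ p≤0 = ℚ.≤-trans p≤0 (ℚ.0≤∣p∣ p)

q-p≤∣p-q∣ : ∀ p q → q ℚ.- p ℚ.≤ ℚ.∣ p ℚ.- q ∣
q-p≤∣p-q∣ p q = subst (q ℚ.- p ℚ.≤_)
  (trans (cong ℚ.∣_∣ (swap p q)) (ℚ.∣-p∣≡∣p∣ (p ℚ.- q))) (p≤∣p∣ (q ℚ.- p))
  where
  open +-*-Solver
  swap : ∀ p q → q ℚ.- p ≡ ℚ.- (p ℚ.- q)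
  swap = solve 2 (λ p q → q :- p := :- (p :- q)) refl

-- Finite and infinite limits exclude each other.

converges⇒¬⟶+∞ : ∀ {s l} → s ⟶ l → ¬ (s ⟶+∞)
converges⇒¬⟶+∞ {s} {l} s⟶l s⟶∞ =
  let (N₁ , near) = s⟶l (fromℚ 1ℚ) (fromℚ-pos {1ℚ} (ℚ.positive⁻¹ 1ℚ))
      (N₂ , far)  = s⟶∞ (l + fromℚ 1ℚ)
      n = N₁ ℕ.⊔ N₂
      (i₁ , near′) = <⇒approx< {∣ s n - l ∣} {fromℚ 1ℚ} (near n (ℕ.m≤m⊔n N₁ N₂))
      (i₂ , far′)  = <⇒approx< {l + fromℚ 1ℚ} {s n} (far n (ℕ.m≤n⊔m N₁ N₂))
      i = i₁ ℕ.⊔ i₂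
      x = approx (s n) i
      y = approx l i
  in ℚ.<-irrefl refl (begin-strict
    y ℚ.+ 1ℚ         <⟨ far′ i (ℕ.m≤n⊔m i₁ i₂) ⟩
    x                ≡⟨ x≡ x y ⟩
    y ℚ.+ (x ℚ.- y)  ≤⟨ ℚ.+-monoʳ-≤ y (p≤∣p∣ (x ℚ.- y)) ⟩
    y ℚ.+ ℚ.∣ x ℚ.- y ∣ <⟨ ℚ.+-monoʳ-< y (near′ i (ℕ.m≤m⊔n i₁ i₂)) ⟩
    y ℚ.+ 1ℚ         ∎)
  where
  open ℚ.≤-Reasoning
  open +-*-Solver
  x≡ : ∀ x y → x ≡ y ℚ.+ (x ℚ.- y)
  x≡ = solve 2 (λ x y → x := y :+ (x :- y)) refl

converges⇒¬⟶-∞ : ∀ {s l} → s ⟶ l → ¬ (s ⟶-∞)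
converges⇒¬⟶-∞ {s} {l} s⟶l s⟶-∞ =
  let (N₁ , near) = s⟶l (fromℚ 1ℚ) (fromℚ-pos {1ℚ} (ℚ.positive⁻¹ 1ℚ))
      (N₂ , far)  = s⟶-∞ (l - fromℚ 1ℚ)
      n = N₁ ℕ.⊔ N₂
      (i₁ , near′) = <⇒approx< {∣ s n - l ∣} {fromℚ 1ℚ} (near n (ℕ.m≤m⊔n N₁ N₂))
      (i₂ , far′)  = <⇒approx< {s n} {l - fromℚ 1ℚ} (far n (ℕ.m≤n⊔m N₁ N₂))
      i = i₁ ℕ.⊔ i₂
      x = approx (s n) i
      y = approx l i
  in ℚ.<-irrefl refl (begin-strict
    y                          ≡⟨ y≡ x y ⟩
    (y ℚ.- x) ℚ.+ x            ≤⟨ ℚ.+-monoˡ-≤ x (q-p≤∣p-q∣ x y) ⟩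
    ℚ.∣ x ℚ.- y ∣ ℚ.+ x        <⟨ ℚ.+-mono-< (near′ i (ℕ.m≤m⊔n i₁ i₂)) (far′ i (ℕ.m≤n⊔m i₁ i₂)) ⟩
    1ℚ ℚ.+ (y ℚ.- 1ℚ)          ≡⟨ 1+ y ⟩
    y                          ∎)
  where
  open ℚ.≤-Reasoning
  open +-*-Solver
  y≡ : ∀ x y → y ≡ (y ℚ.- x) ℚ.+ x
  y≡ = solve 2 (λ x y → y := (y :- x) :+ x) refl
  1+ : ∀ y → 1ℚ ℚ.+ (y ℚ.- 1ℚ) ≡ y
  1+ = solve 1 (λ y → con 1ℚ :+ (y :- con 1ℚ) := y) refl

divergesToInfinity⇒diverges : ∀ a → DivergesToInfinity a → Diverges a
divergesToInfinity⇒diverges a (inj₁ +∞) (l , a⟶l) = converges⇒¬⟶+∞ {partialSum a} {l} a⟶l +∞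
divergesToInfinity⇒diverges a (inj₂ -∞) (l , a⟶l) = converges⇒¬⟶-∞ {partialSum a} {l} a⟶l -∞

-- Series with rational terms.

sumℚ : (ℕ → ℚ) → ℕ → ℚ
sumℚ r zero    = 0ℚ
sumℚ r (suc n) = sumℚ r n ℚ.+ r n

-- Equality at every index `i`, rather than in the limit, makes the approximations of the partial
-- sums exact as well.
_HasTerms_ : Series → (ℕ → ℚ) → Set
a HasTerms r = ∀ n i → approx (a n) i ≡ r n

partialSum-rational : ∀ {a r} → a HasTerms r →
                      ∀ n i → approx (partialSum a n) i ≡ sumℚ r n
partialSum-rational terms zero    i = refl
partialSum-rational terms (suc n) i =
  cong₂ ℚ._+_ (partialSum-rational terms n i) (terms n i)

converges-rational : ∀ {a r} → a HasTerms r → ∀ L →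
  (∀ δ → 0ℚ ℚ.< δ → ∃[ N ] ∀ n → N ℕ.≤ n → ℚ.∣ sumℚ r n ℚ.- L ∣ ℚ.≤ δ) →
  Converges a
converges-rational {a} {r} terms L lim = fromℚ L , λ ε (δ , δ>0 , K , δ≤ε) →
  -- Real `<` asks for a positive gap: half of `δ` bounds the distance, the other half is the gap.
  let (N , close) = lim (½ ℚ.* δ) (halve-pos δ>0)
  in N , λ n N≤n → ½ ℚ.* δ , halve-pos δ>0 , K , λ i K≤i → begin
    ℚ.∣ approx (partialSum a n) i ℚ.- L ∣ ℚ.+ ½ ℚ.* δ
      ≡⟨ cong (λ x → ℚ.∣ x ℚ.- L ∣ ℚ.+ ½ ℚ.* δ) (partialSum-rational terms n i) ⟩
    ℚ.∣ sumℚ r n ℚ.- L ∣ ℚ.+ ½ ℚ.* δ  ≤⟨ ℚ.+-monoˡ-≤ (½ ℚ.* δ) (close n N≤n) ⟩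
    ½ ℚ.* δ ℚ.+ ½ ℚ.* δ               ≡⟨ ½p+½p≡p δ ⟩
    δ                                 ≡⟨ ℚ.+-identityˡ δ ⟨
    0ℚ ℚ.+ δ                          ≤⟨ δ≤ε i K≤i ⟩
    approx ε i                        ∎
  where open ℚ.≤-Reasoning

-- The partial sums are not Cauchy: a limit would eventually put any two of them less than `ε`
-- apart.
diverges-rational : ∀ {a r} → a HasTerms r → ∀ ε → 0ℚ ℚ.< ε →
  (∀ N → ∃[ n ] N ℕ.≤ n × sumℚ r N ℚ.+ ε ℚ.≤ sumℚ r n) → Diverges a
diverges-rational {a} {r} terms ε ε>0 jump (l , a⟶l) =
  let (N , near) = a⟶l (fromℚ (½ ℚ.* ε)) (fromℚ-pos (halve-pos ε>0))
      (n , N≤n , big) = jump N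
      (i₁ , near₁) = <⇒approx< {∣ partialSum a N - l ∣} {fromℚ (½ ℚ.* ε)} (near N ℕ.≤-refl)
      (i₂ , near₂) = <⇒approx< {∣ partialSum a n - l ∣} {fromℚ (½ ℚ.* ε)} (near n N≤n)
      i = i₁ ℕ.⊔ i₂
      x = approx (partialSum a N) i
      y = approx (partialSum a n) i
      z = approx l i
  in ℚ.<-irrefl refl (begin-strict
    x ℚ.+ ε                      ≡⟨ cong (ℚ._+ ε) (partialSum-rational terms N i) ⟩
    sumℚ r N ℚ.+ ε               ≤⟨ big ⟩
    sumℚ r n                     ≡⟨ partialSum-rational terms n i ⟨
    y                            ≡⟨ via x y z ⟩
    x ℚ.+ ((z ℚ.- x) ℚ.+ (y ℚ.- z))
      ≤⟨ ℚ.+-monoʳ-≤ x (ℚ.+-mono-≤ (q-p≤∣p-q∣ x z) (p≤∣p∣ (y ℚ.- z))) ⟩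
    x ℚ.+ (ℚ.∣ x ℚ.- z ∣ ℚ.+ ℚ.∣ y ℚ.- z ∣)
      <⟨ ℚ.+-monoʳ-< x (ℚ.+-mono-< (near₁ i (ℕ.m≤m⊔n i₁ i₂)) (near₂ i (ℕ.m≤n⊔m i₁ i₂))) ⟩
    x ℚ.+ (½ ℚ.* ε ℚ.+ ½ ℚ.* ε)  ≡⟨ cong (x ℚ.+_) (½p+½p≡p ε) ⟩
    x ℚ.+ ε                      ∎)
  where
  open ℚ.≤-Reasoning
  open +-*-Solver
  via : ∀ x y z → y ≡ x ℚ.+ ((z ℚ.- x) ℚ.+ (y ℚ.- z))
  via = solve 3 (λ x y z → y := x :+ ((z :- x) :+ (y :- z))) refl

-- The harmonic series.

fromℕ : ℕ → ℚ
fromℕ n = mkℚ (+ n) 0 (Coprimality.sym (1-coprimeTo n))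

fromℕ-+ : ∀ m n → fromℕ (m ℕ.+ n) ≡ fromℕ m ℚ.+ fromℕ n
fromℕ-+ m n = ℚ.toℚᵘ-injective (ℚᵘ.≃-trans
  (ℚᵘ.*≡* (cong (λ k → k ℤ.* + 1)
    (trans (ℤ.pos-+ m n) (sym (cong₂ ℤ._+_ (ℤ.*-identityʳ (+ m)) (ℤ.*-identityʳ (+ n)))))))
  (ℚᵘ.≃-sym (ℚ.toℚᵘ-homo-+ (fromℕ m) (fromℕ n))))

1/1+ : ℕ → ℚ
1/1+ m = mkℚ (+ 1) m (1-coprimeTo (suc m))

0≤1/1+ : ∀ m → 0ℚ ℚ.≤ 1/1+ m
0≤1/1+ m = ℚ.nonNegative⁻¹ (1/1+ m)

1/1+-antitone : ∀ {m n} → m ℕ.≤ n → 1/1+ n ℚ.≤ 1/1+ m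
1/1+-antitone m≤n = *≤* (+≤+ (ℕ.+-monoˡ-≤ 0 (s≤s m≤n)))

1/1+-small : ∀ δ → 0ℚ ℚ.< δ → ∃[ K ] ∀ m → K ℕ.≤ m → 1/1+ m ℚ.≤ δ
-- Here `δ` is `(a + 1) / (d + 1)`, hence at least `1/1+ d`.
1/1+-small (mkℚ +[1+ a ] d _) _ = d , λ m d≤m →
  ℚ.≤-trans (1/1+-antitone d≤m) (*≤* (+≤+ (ℕ.*-monoˡ-≤ (suc d) (s≤s (z≤n {a})))))
1/1+-small (mkℚ (+ 0) d _) δ>0 with () ← ℚ.positive δ>0
1/1+-small (mkℚ -[1+ a ] d _) δ>0 with () ← ℚ.positive δ>0

-- Both fractions are given in lowest terms, so `1/1+ m` is definitionally the reciprocal of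
-- `fromℕ (suc m)`.
n/n : ∀ m → fromℕ (suc m) ℚ.* 1/1+ m ≡ 1ℚ
n/n m = ℚ.*-inverseʳ (fromℕ (suc m))

harmonic : ℕ → ℚ
harmonic = sumℚ 1/1+

harmonic-mono : ∀ {m n} → m ℕ.≤ n → harmonic m ℚ.≤ harmonic n
harmonic-mono = mono ∘ ℕ.≤⇒≤′
  where
  mono : ∀ {m n} → m ℕ.≤′ n → harmonic m ℚ.≤ harmonic n
  mono ℕ.≤′-refl = ℚ.≤-refl
  mono (ℕ.≤′-step {n} m≤n) = ℚ.≤-trans (mono m≤n)
    (subst (ℚ._≤ harmonic (suc n)) (ℚ.+-identityʳ (harmonic n))
      (ℚ.+-monoʳ-≤ (harmonic n) (0≤1/1+ n)))

-- Each of the `j` terms following the first `M` has index at most `k`, hence is at least `1/1+ k`.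
harmonic-block : ∀ M j k → j ℕ.+ M ℕ.≤ suc k →
  harmonic M ℚ.+ fromℕ j ℚ.* 1/1+ k ℚ.≤ harmonic (j ℕ.+ M)
harmonic-block M zero    k _ = ℚ.≤-reflexive
  (trans (cong (harmonic M ℚ.+_) (ℚ.*-zeroˡ (1/1+ k))) (ℚ.+-identityʳ (harmonic M)))
harmonic-block M (suc j) k (s≤s j+M≤k) = begin
  harmonic M ℚ.+ fromℕ (suc j) ℚ.* x
    ≡⟨ cong (λ y → harmonic M ℚ.+ y ℚ.* x) (fromℕ-+ 1 j) ⟩
  harmonic M ℚ.+ (1ℚ ℚ.+ fromℕ j) ℚ.* x    ≡⟨ expand (harmonic M) (fromℕ j) x ⟩
  (harmonic M ℚ.+ fromℕ j ℚ.* x) ℚ.+ x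
    ≤⟨ ℚ.+-mono-≤ (harmonic-block M j k (ℕ.m≤n⇒m≤1+n j+M≤k)) (1/1+-antitone j+M≤k) ⟩
  harmonic (suc j ℕ.+ M)                   ∎
  where
  open ℚ.≤-Reasoning
  open +-*-Solver
  x = 1/1+ k
  expand : ∀ h y x → h ℚ.+ (1ℚ ℚ.+ y) ℚ.* x ≡ (h ℚ.+ y ℚ.* x) ℚ.+ x
  expand = solve 3 (λ h y x → h :+ (con 1ℚ :+ y) :* x := (h :+ y :* x) :+ x) refl

-- Oresme's argument: the `M + 1` added terms are each at least `1 / (2M + 2)`, a bound chosen to
-- make the total exactly one half.
harmonic-jump : ∀ M → harmonic M ℚ.+ ½ ℚ.≤ harmonic (suc M ℕ.+ M)
harmonic-jump M = subst (λ y → harmonic M ℚ.+ y ℚ.≤ harmonic (suc M ℕ.+ M)) half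
  (harmonic-block M (suc M) k (s≤s (ℕ.+-monoʳ-≤ M (ℕ.n≤1+n M))))
  where
  open +-*-Solver
  k = M ℕ.+ suc M
  y = fromℕ (suc M)
  factor : ∀ y x → y ℚ.* x ≡ ½ ℚ.* ((y ℚ.+ y) ℚ.* x)
  factor = solve 2 (λ y x → y :* x := con ½ :* ((y :+ y) :* x)) refl
  half : y ℚ.* 1/1+ k ≡ ½
  half = trans (factor y (1/1+ k)) (cong (½ ℚ.*_)
    (trans (cong (ℚ._* 1/1+ k) (sym (fromℕ-+ (suc M) (suc M)))) (n/n k)))

-- The series of cancelling pairs.

module PairedSeries
  (p q : ℕ → ℕ)
  (p<q : ∀ m → p m ℕ.< q m)
  (q<p : ∀ m → q m ℕ.< p (suc m))
  where

  -- The pair being processed at index n: the least m with n ≤ q m.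
  current : ℕ → ℕ
  current zero    = 0
  current (suc n) =
    if does (n ℕ.≟ q (current n)) then suc (current n) else current n

  pairTerm : ℕ → ℕ → ℚ
  pairTerm m n = if does (n ℕ.≟ p m) then 1/1+ m
                 else if does (n ℕ.≟ q m) then ℚ.- 1/1+ m else 0ℚ

  -- Only the current pair can contain `n`: earlier pairs lie below `n`, later ones above
  -- `q (current n)`, which is at least `n`.
  term : ℕ → ℚ
  term n = pairTerm (current n) n

  series : Series
  series n = fromℚ (term n)

  current-suc-at : ∀ {n} → n ≡ q (current n) → current (suc n) ≡ suc (current n)
  current-suc-at {n} eq rewrite dec-true (n ℕ.≟ q (current n)) eq = refl

  current-suc-off : ∀ {n} → n ≢ q (current n) → current (suc n) ≡ current n
  current-suc-off {n} neq rewrite dec-false (n ℕ.≟ q (current n)) neq = refl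

  pairTerm-p : ∀ {m n} → n ≡ p m → pairTerm m n ≡ 1/1+ m
  pairTerm-p {m} {n} eq rewrite dec-true (n ℕ.≟ p m) eq = refl

  pairTerm-q : ∀ {m n} → n ≡ q m → pairTerm m n ≡ ℚ.- 1/1+ m
  pairTerm-q {m} {n} refl
    rewrite dec-false (n ℕ.≟ p m) (ℕ.<⇒≢ (p<q m) ∘ sym) | dec-true (n ℕ.≟ q m) refl = refl

  pairTerm-other : ∀ {m n} → n ≢ p m → n ≢ q m → pairTerm m n ≡ 0ℚ
  pairTerm-other {m} {n} n≢p n≢q
    rewrite dec-false (n ℕ.≟ p m) n≢p | dec-false (n ℕ.≟ q m) n≢q = refl

  q<q : ∀ m → q m ℕ.< q (suc m)
  q<q m = ℕ.<-trans (q<p m) (p<q (suc m))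

  q-mono : ∀ {m n} → m ℕ.≤ n → q m ℕ.≤ q n
  q-mono = mono ∘ ℕ.≤⇒≤′
    where
    mono : ∀ {m n} → m ℕ.≤′ n → q m ℕ.≤ q n
    mono ℕ.≤′-refl           = ℕ.≤-refl
    mono (ℕ.≤′-step {n} m≤n) = ℕ.≤-trans (mono m≤n) (ℕ.<⇒≤ (q<q n))

  n≤q-current : ∀ n → n ℕ.≤ q (current n)
  n≤q-current zero = z≤n
  n≤q-current (suc n) with n ℕ.≟ q (current n)
  ... | yes eq rewrite current-suc-at eq =
    subst (ℕ._< q (suc (current n))) (sym eq) (q<q (current n))
  ... | no neq rewrite current-suc-off neq = ℕ.≤∧≢⇒< (n≤q-current n) neq

  -- Otherwise `n ≤ q (current n) ≤ q m`. This is how `current` is pushed past any prescribed pair.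
  q<n⇒<current : ∀ {m n} → q m ℕ.< n → m ℕ.< current n
  q<n⇒<current {m} {n} q<n = ℕ.≰⇒> λ cur≤m →
    ℕ.<⇒≱ q<n (ℕ.≤-trans (n≤q-current n) (q-mono cur≤m))

  -- The contribution to the partial sum over A of a pair opened before n and
  -- not yet closed.
  pending : Subset → ℕ → ℕ → ℚ
  pending A m n = if does (p m ℕ.<? n) ∧ A (p m) then 1/1+ m else 0ℚ

  pending-before : ∀ A {m n} → n ℕ.≤ p m → pending A m n ≡ 0ℚ
  pending-before A {m} {n} n≤p rewrite dec-false (p m ℕ.<? n) (ℕ.≤⇒≯ n≤p) = refl

  pending-after : ∀ A {m n} → p m ℕ.< n → pending A m n ≡ (if A (p m) then 1/1+ m else 0ℚ)
  pending-after A {m} {n} p<n rewrite dec-true (p m ℕ.<? n) p<n = refl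

  pending-bound : ∀ A m n → ℚ.∣ pending A m n ∣ ℚ.≤ 1/1+ m
  pending-bound A m n with does (p m ℕ.<? n) ∧ A (p m)
  ... | true  = ℚ.≤-refl
  ... | false = 0≤1/1+ m

  restrict : Subset → ℕ → ℚ
  restrict A n = if A n then term n else 0ℚ

  -- The index `n` opens the current pair, closes it or carries the term 0. On closing, `same`
  -- ensures that both terms are kept or both dropped, so nothing stays pending.
  pending-step : ∀ A n → A (p (current n)) ≡ A (q (current n)) →
    pending A (current n) n ℚ.+ restrict A n ≡ pending A (current (suc n)) (suc n)
  pending-step A n same with n ℕ.≟ q (current n)
  ... | yes n≡q = begin
    pending A m n ℚ.+ restrict A n
      ≡⟨ cong₂ ℚ._+_ (pending-after A (subst (p m ℕ.<_) (sym n≡q) (p<q m)))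
           (cong₂ (λ b x → if b then x else 0ℚ)
             (trans (cong A n≡q) (sym same)) (pairTerm-q n≡q)) ⟩
    (if A (p m) then 1/1+ m else 0ℚ) ℚ.+ (if A (p m) then ℚ.- 1/1+ m else 0ℚ)
      ≡⟨ cancel (A (p m)) ⟩
    0ℚ
      ≡⟨ pending-before A (subst (ℕ._< p (suc m)) (sym n≡q) (q<p m)) ⟨
    pending A (suc m) (suc n)
      ≡⟨ cong (λ k → pending A k (suc n)) (current-suc-at n≡q) ⟨
    pending A (current (suc n)) (suc n) ∎
    where
    open ≡-Reasoning
    m = current n
    cancel : ∀ b → (if b then 1/1+ m else 0ℚ) ℚ.+ (if b then ℚ.- 1/1+ m else 0ℚ) ≡ 0ℚ
    cancel true  = ℚ.+-inverseʳ (1/1+ m)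
    cancel false = refl
  ... | no n≢q = trans (inside (n ℕ.≟ p m))
      (cong (λ k → pending A k (suc n)) (sym (current-suc-off n≢q)))
    where
    open ≡-Reasoning
    m = current n
    inside : Dec (n ≡ p m) → pending A m n ℚ.+ restrict A n ≡ pending A m (suc n)
    inside (yes n≡p) = begin
      pending A m n ℚ.+ restrict A n
        ≡⟨ cong₂ ℚ._+_ (pending-before A (ℕ.≤-reflexive n≡p))
             (cong₂ (λ b x → if b then x else 0ℚ) (cong A n≡p) (pairTerm-p n≡p)) ⟩
      0ℚ ℚ.+ (if A (p m) then 1/1+ m else 0ℚ)
        ≡⟨ ℚ.+-identityˡ _ ⟩
      (if A (p m) then 1/1+ m else 0ℚ)
        ≡⟨ pending-after A (s≤s (ℕ.≤-reflexive (sym n≡p))) ⟨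
      pending A m (suc n) ∎
    inside (no n≢p) = begin
      pending A m n ℚ.+ restrict A n
        ≡⟨ cong (pending A m n ℚ.+_) (trans
             (cong (λ x → if A n then x else 0ℚ) (pairTerm-other n≢p n≢q))
             (if-eta (A n))) ⟩
      pending A m n ℚ.+ 0ℚ   ≡⟨ ℚ.+-identityʳ _ ⟩
      pending A m n          ≡⟨ unchanged (p m ℕ.<? n) ⟩
      pending A m (suc n)    ∎
      where
      unchanged : Dec (p m ℕ.< n) → pending A m n ≡ pending A m (suc n)
      unchanged (yes p<n) =
        trans (pending-after A p<n) (sym (pending-after A (ℕ.m<n⇒m<1+n p<n)))
      unchanged (no p≮n) =
        trans (pending-before A (ℕ.≮⇒≥ p≮n))
              (sym (pending-before A (ℕ.≤∧≢⇒< (ℕ.≮⇒≥ p≮n) n≢p)))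

  restrict-terms : ∀ A → (series ↾ A) HasTerms restrict A
  restrict-terms A n i with A n
  ... | true  = refl
  ... | false = refl

  EventuallyUnseparated : Subset → Set
  EventuallyUnseparated A = ∃[ M ] ∀ m → M ℕ.≤ m → A (p m) ≡ A (q m)

  -- Once the current pair lies beyond `M`, the partial sum minus the pending term is constant. The
  -- pending term is at most `1/1+ (current n)`, which tends to 0, so this constant is the limit.
  subseries-converges : ∀ A → EventuallyUnseparated A → Converges (series ↾ A)
  subseries-converges A (M , same) = converges-rational (restrict-terms A) L λ δ δ>0 →
    let (K , small) = 1/1+-small δ δ>0
    in N ℕ.⊔ suc (q K) , λ n N⊔K≤n → begin
      ℚ.∣ S n ℚ.- L ∣
        ≡⟨ cong (λ x → ℚ.∣ x ℚ.- L ∣) (sum-pending (ℕ.≤⇒≤′ (ℕ.m⊔n≤o⇒m≤o N (suc (q K)) N⊔K≤n))) ⟩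
      ℚ.∣ (L ℚ.+ P n) ℚ.- L ∣   ≡⟨ cong ℚ.∣_∣ (drop L (P n)) ⟩
      ℚ.∣ P n ∣                 ≤⟨ pending-bound A (current n) n ⟩
      1/1+ (current n)
        ≤⟨ small (current n) (ℕ.<⇒≤ (q<n⇒<current (ℕ.m⊔n≤o⇒n≤o N (suc (q K)) N⊔K≤n))) ⟩
      δ ∎
    where
    open ℚ.≤-Reasoning
    open +-*-Solver
    S = sumℚ (restrict A)
    P : ℕ → ℚ
    P n = pending A (current n) n
    -- Past `q M` every current pair has a number above `M`, so `same` applies at each further step.
    N = suc (q M)
    L = S N ℚ.- P N
    drop : ∀ x y → (x ℚ.+ y) ℚ.- x ≡ y
    drop = solve 2 (λ x y → (x :+ y) :- x := y) refl
    split : ∀ x y → x ≡ (x ℚ.- y) ℚ.+ y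
    split = solve 2 (λ x y → x := (x :- y) :+ y) refl
    sum-pending : ∀ {n} → N ℕ.≤′ n → S n ≡ L ℚ.+ P n
    sum-pending ℕ.≤′-refl = split (S N) (P N)
    sum-pending (ℕ.≤′-step {n} N≤n) = trans
      (cong (ℚ._+ restrict A n) (sum-pending N≤n))
      (trans (ℚ.+-assoc L (P n) (restrict A n))
        (cong (L ℚ.+_) (pending-step A n
          (same (current n) (ℕ.<⇒≤ (q<n⇒<current (ℕ.≤′⇒≤ N≤n)))))))

  absTerm : ℕ → ℚ
  absTerm n = ℚ.∣ term n ∣

  -- The left side grows only when a pair closes, and then by the absolute value of the closing
  -- term; elsewhere `absTerm` is only bounded below by 0.
  harmonic-current-step : ∀ n →
    harmonic (current (suc n)) ℚ.≤ harmonic (current n) ℚ.+ absTerm n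
  harmonic-current-step n with n ℕ.≟ q (current n)
  ... | yes n≡q = ℚ.≤-reflexive (trans (cong harmonic (current-suc-at n≡q))
    (cong (harmonic (current n) ℚ.+_) (sym (cong ℚ.∣_∣ (pairTerm-q n≡q)))))
  ... | no n≢q = subst₂ ℚ._≤_
    (trans (ℚ.+-identityʳ _) (cong harmonic (sym (current-suc-off n≢q)))) refl
    (ℚ.+-monoʳ-≤ (harmonic (current n)) (ℚ.0≤∣p∣ (term n)))

  harmonic-current-sum : ∀ {N n} → N ℕ.≤′ n →
    sumℚ absTerm N ℚ.+ harmonic (current n) ℚ.≤ sumℚ absTerm n ℚ.+ harmonic (current N)
  harmonic-current-sum ℕ.≤′-refl = ℚ.≤-refl
  harmonic-current-sum {N} (ℕ.≤′-step {n} N≤n) = begin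
    S N ℚ.+ H (suc n)            ≤⟨ ℚ.+-monoʳ-≤ (S N) (harmonic-current-step n) ⟩
    S N ℚ.+ (H n ℚ.+ absTerm n)  ≡⟨ ℚ.+-assoc (S N) (H n) (absTerm n) ⟨
    (S N ℚ.+ H n) ℚ.+ absTerm n  ≤⟨ ℚ.+-monoˡ-≤ (absTerm n) (harmonic-current-sum N≤n) ⟩
    (S n ℚ.+ H N) ℚ.+ absTerm n  ≡⟨ exchange (S n) (H N) (absTerm n) ⟩
    S (suc n) ℚ.+ H N            ∎
    where
    open ℚ.≤-Reasoning
    open +-*-Solver
    S = sumℚ absTerm
    H : ℕ → ℚ
    H = harmonic ∘ current
    exchange : ∀ x y z → (x ℚ.+ y) ℚ.+ z ≡ (x ℚ.+ z) ℚ.+ y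
    exchange = solve 3 (λ x y z → (x :+ y) :+ z := (x :+ z) :+ y) refl

  -- From `N` to `n` the absolute sums gain at least what the harmonic sums gain from `current N` to
  -- `current n`, and a suitable `n` makes that at least one half.
  absolutely-diverges : ¬ ConvergesAbsolutely series
  absolutely-diverges = diverges-rational {r = absTerm} (λ _ _ → refl) ½ (ℚ.positive⁻¹ ½) λ N →
    let M = current N
        -- Past `q (suc M + M)` the current pair exceeds `suc M + M`, where `harmonic-jump` applies.
        n = N ℕ.⊔ suc (q (suc M ℕ.+ M))
        N≤n = ℕ.m≤m⊔n N _
        q<n = ℕ.m≤n⊔m N (suc (q (suc M ℕ.+ M)))
    in n , N≤n , ℚ.≤-trans (ℚ.≤-reflexive (lhs (S N) (harmonic M))) (ℚ.≤-trans
      (ℚ.+-monoˡ-≤ (ℚ.- harmonic M) (begin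
        S N ℚ.+ (harmonic M ℚ.+ ½)        ≤⟨ ℚ.+-monoʳ-≤ (S N) (harmonic-jump M) ⟩
        S N ℚ.+ harmonic (suc M ℕ.+ M)
          ≤⟨ ℚ.+-monoʳ-≤ (S N) (harmonic-mono (ℕ.<⇒≤ (q<n⇒<current q<n))) ⟩
        S N ℚ.+ harmonic (current n)      ≤⟨ harmonic-current-sum (ℕ.≤⇒≤′ N≤n) ⟩
        S n ℚ.+ harmonic M                ∎))
      (ℚ.≤-reflexive (rhs (S n) (harmonic M))))
    where
    open ℚ.≤-Reasoning
    open +-*-Solver
    S = sumℚ absTerm
    lhs : ∀ x h → x ℚ.+ ½ ≡ (x ℚ.+ (h ℚ.+ ½)) ℚ.- h
    lhs = solve 2 (λ x h → x :+ con ½ := (x :+ (h :+ con ½)) :- h) refl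
    rhs : ∀ x h → (x ℚ.+ h) ℚ.- h ≡ x
    rhs = solve 2 (λ x h → (x :+ h) :- h := x) refl

  converges-conditionally : ConvergesConditionally series
  converges-conditionally =
    -- Restricting to the full index set returns the series definitionally, and this set separates
    -- no pair.
    subseries-converges (λ _ → true) (0 , λ _ _ → refl) , absolutely-diverges

-- Pairs unseparated by finitely many sets.

bit : Bool → Fin 2
bit false = zero
bit true  = suc zero

bit-injective : ∀ {b b′} → bit b ≡ bit b′ → b ≡ b′
bit-injective {false} {false} _ = refl
bit-injective {true}  {true}  _ = refl

module UnseparatedPairs (A : ℕ → Subset) where

  -- Coding membership in the first `m` sets as an element of `Fin (2 ^ m)` makes the pigeonhole
  -- principle directly applicable.
  membership : ∀ m → ℕ → Fin (2 ℕ.^ m)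
  membership m n = funToFin {m} (λ k → bit (A (toℕ k) n))

  membership-injective : ∀ m {n n′} → membership m n ≡ membership m n′ →
                         ∀ {k} → k ℕ.< m → A k n ≡ A k n′
  membership-injective m {n} {n′} eq {k} k<m =
    subst (λ k → A k n ≡ A k n′) (toℕ-fromℕ< k<m) (bit-injective (trans
      (sym (finToFun-funToFin {m} _ (fromℕ< k<m)))
      (trans (cong (λ f → finToFun {2} {m} f (fromℕ< k<m)) eq)
             (finToFun-funToFin {m} _ (fromℕ< k<m)))))

  -- The `2 ^ m + 1` consecutive numbers from `s` on have only `2 ^ m` possible codes.
  unseparated-pair : ∀ m s → ∃[ p ] ∃[ q ] s ℕ.≤ p × p ℕ.< q ×
                     (∀ {k} → k ℕ.< m → A k p ≡ A k q)
  unseparated-pair m s =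
    let (i , j , i<j , eq) = pigeonhole (ℕ.n<1+n (2 ℕ.^ m)) (λ i → membership m (s ℕ.+ toℕ i))
    in s ℕ.+ toℕ i , s ℕ.+ toℕ j , ℕ.m≤m+n s (toℕ i) , ℕ.+-monoʳ-< s i<j ,
       membership-injective m eq

  -- The search resumes one past the previous `q`, so the lower bound on the next `p` is literally
  -- `q m < p (suc m)`.
  start : ℕ → ℕ
  start zero    = 0
  start (suc m) = suc (proj₁ (proj₂ (unseparated-pair m (start m))))

  p q : ℕ → ℕ
  p m = proj₁ (unseparated-pair m (start m))
  q m = proj₁ (proj₂ (unseparated-pair m (start m)))

  p<q : ∀ m → p m ℕ.< q m
  p<q m = let (_ , _ , _ , p<q , _) = unseparated-pair m (start m) in p<q

  q<p : ∀ m → q m ℕ.< p (suc m)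
  q<p m = let (_ , _ , q<p , _) = unseparated-pair (suc m) (start (suc m)) in q<p

  unseparated : ∀ {k m} → k ℕ.< m → A k (p m) ≡ A k (q m)
  unseparated {k} {m} = let (_ , _ , _ , _ , same) = unseparated-pair m (start m) in same

-- `B` ranges over the sets extensionally equal to some `A k`, since an enumeration of a family hits
-- its members only up to that equality.
countable-subseries-converge : ∀ (A : ℕ → Subset) →
  ∃[ a ] ConvergesConditionally a ×
         (∀ B k → (∀ n → A k n ≡ B n) → Converges (a ↾ B))
countable-subseries-converge A = series , converges-conditionally , λ B k A≗B →
  -- The pair numbered `m` is chosen to respect the sets with index below `m`, so the tail for `A k`
  -- starts at `suc k`.
  subseries-converges B (suc k , λ m k<m →
    trans (sym (A≗B (p m))) (trans (unseparated k<m) (A≗B (q m))))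
  where
  open UnseparatedPairs A
  open PairedSeries p q p<q q<p

-- Uncountability of families and of least cardinalities.

ß-Family⇒uncountable : ∀ (𝒜 : Pred Subset ℓ) → ß-Family 𝒜 → Uncountable ⟦ 𝒜 ⟧
ß-Family⇒uncountable 𝒜 family (f , f-onto) =
  let (a , cond , conv) = countable-subseries-converge (member ∘ f)
      (B , B∈𝒜 , div)   = family a cond
      (k , fk≈B)        = f-onto (B , B∈𝒜)
  in div (conv B k (member-≗ fk≈B))
  where
  member : Maybe (∃ 𝒜) → Subset
  -- An index listing no member stands for the empty set; an extra set in the sequence does no harm.
  member = maybe proj₁ (λ _ → false)

  member-≗ : ∀ {x y} → Pointwise (Setoid._≈_ ⟦ 𝒜 ⟧) x (just y) →
             ∀ n → member x n ≡ proj₁ y n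
  member-≗ (just eq) = eq

-- The enumeration is pulled back along chosen preimages; injectivity makes the preimage of anything
-- equivalent to `to x` equivalent to `x`.
countable-bijection : ∀ {c₁ e₁ c₂ e₂} {S : Setoid c₁ e₁} {T : Setoid c₂ e₂} →
                      Bijection S T → Countable T → Countable S
countable-bijection {S = S} {T = T} bij (f , f-onto) = Maybe.map to⁻ ∘ f , λ x →
  let (n , fn≈) = f-onto (to x) in n , back fn≈
  where
  open Bijection bij
  module S = Setoid S
  module T = Setoid T

  back : ∀ {y x} → Pointwise T._≈_ y (just (to x)) →
         Pointwise S._≈_ (Maybe.map to⁻ y) (just x)
  back {just y} (just y≈) = just (injective (T.trans (proj₂ (surjective y) S.refl) y≈))

-- A least cardinality is in bijection with a family satisfying `P`, so its countability would carry
-- over to that family.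
leastCardinalityUncountable : ∀ {P : Pred (Pred Subset ℓ) ℓ} → P ⊆ ß-Family →
                              LeastCardinalityUncountable c e P
leastCardinalityUncountable P⊆ß =
  (λ κ least κ-countable →
    let (𝒜 , P𝒜 , bij) = IsLeastCardinality.attained least
    in ß-Family⇒uncountable 𝒜 (P⊆ß P𝒜) (countable-bijection bij κ-countable)) ,
  (λ 𝒜 P𝒜 → ß-Family⇒uncountable 𝒜 (P⊆ß P𝒜))

-- The set `A` chosen for the stronger mode of divergence serves for the weaker one; this reduces
-- `ßᵢ-Family` and `ßₒ-Family` to `ß-Family`.
subseriesFamily-mono : ∀ {D E : Pred Series 0ℓ} → (∀ a → D a → E a) →
  ∀ {𝒜 : Pred Subset ℓ} → SubseriesFamily D 𝒜 → SubseriesFamily E 𝒜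
subseriesFamily-mono D⇒E family a cond =
  let (A , A∈𝒜 , d) = family a cond in A , A∈𝒜 , D⇒E (a ↾ A) d

corollary8 : ∀ {ℓ c e : Level} →
    LeastCardinalityUncountable {ℓ} c e ß-Family ×
    LeastCardinalityUncountable {ℓ} c e ßᵢ-Family ×
    LeastCardinalityUncountable {ℓ} c e ßₒ-Family
corollary8 =
  leastCardinalityUncountable id ,
  leastCardinalityUncountable
    (subseriesFamily-mono {D = DivergesToInfinity} {Diverges} divergesToInfinity⇒diverges) ,
  leastCardinalityUncountable
    (subseriesFamily-mono {D = DivergesByOscillation} {Diverges} λ _ → proj₁)
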